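{- Let $f(x)\in\mathbf{Z}[x]$ be a separable nonconstant polynomial of even degree, and let $C$ be the hyperelliptic curve $y^2=f(x)$. Let $p$ be a good prime for $f(x)$, and assume that $C(\mathbf{F}_p)=\emptyset$. Let $d$ be any squarefree integer that is a nonzero square modulo $p$. Then $C_d$ does not have a nontrivial point over $\mathbf{Q}_p$.
   Context: Squarefree integers may be negative and are nonzero. An odd prime $p$ is good for $f(x)$ if the reduced polynomial $\bar f(x)\in\mathbf{F}_p[x]$ has the same degree as $f(x)$ and has nonzero discriminant. $C(\mathbf{F}_p)$ denotes the set of $\mathbf{F}_p$-points of the smooth projective hyperelliptic curve over $\mathbf{F}_p$ with affine equation $y^2=\bar f(x)$, including points at infinity; since $\deg f$ is even, there are two $\mathbf{F}_p$-points at infinity if the leading coefficient of $\bar f$ is a square in $\mathbf{F}_p$ and none otherwise. $C_d$ denotes the quadratic twist $dy^2=f(x)$. Points of $C_d$ at infinity and affine points $(x,y)$ with $f(x)=0$ are called trivial; thus $C_d$ has a nontrivial point over $\mathbf{Q}_p$ if and only if there exist $x,y\in\mathbf{Q}_p$ with $dy^2=f(x)$ and $f(x)\ne 0$. -}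

module Defs where

open import Algebra.Bundles.Raw using (RawRing)
import Algebra.Definitions.RawSemiring as RawSemiringDefs
open import Data.Fin.Base using (Fin; zero; suc; toℕ; opposite; punchIn; splitAt)
open import Data.Integer.Base as ℤ using (ℤ; +_; 0ℤ; 1ℤ)
open import Data.Integer.Divisibility.Signed using (_∣_; ∣m∣n⇒∣m+n; ∣m⇒∣-m; ∣n⇒∣m*n; ∣m⇒∣m*n; divides)
open import Data.Integer.Properties using (+-inverseʳ)
open import Data.Integer.Tactic.RingSolver using (solve-∀)
open import Data.List.Base using (List; []; _∷_; _++_; map; replicate)
open import Data.Nat.Base as ℕ using (ℕ; zero; suc)
open import Data.Nat.DivMod using (_/_)
open import Data.Nat.Primality using (Prime)
open import Data.Product.Base using (_×_; ∃-syntax)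
open import Data.Rational.Base as ℚ using (ℚ)
open import Data.Sum.Base using ([_,_]′)
open import Level using (0ℓ)
open import Relation.Binary.PropositionalEquality using (_≡_; _≢_; subst)
open import Relation.Nullary.Negation using (¬_)

-- Polynomials over R as coefficient lists, constant term first.  Trailing
-- zeros are allowed, so a list does not determine the degree by its length.
module Polynomial (R : RawRing 0ℓ 0ℓ) where
  open RawRing R
  open RawSemiringDefs rawSemiring using (sum; _^_) renaming (_×_ to _·_)

  Poly : Set
  Poly = List Carrier

  coeff : Poly → ℕ → Carrier
  coeff []      _       = 0#
  coeff (a ∷ f) zero    = a
  coeff (a ∷ f) (suc k) = coeff f k

  infix 4 _≈ₚ_
  _≈ₚ_ : Poly → Poly → Set
  f ≈ₚ g = ∀ k → coeff f k ≈ coeff g k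

  HasDegree : Poly → ℕ → Set
  HasDegree f n = ¬ (coeff f n ≈ 0#) × (∀ m → n ℕ.< m → coeff f m ≈ 0#)

  eval : Poly → Carrier → Carrier
  eval []      x = 0#
  eval (a ∷ f) x = a + x * eval f x

  infixl 6 _+ₚ_
  _+ₚ_ : Poly → Poly → Poly
  []      +ₚ g       = g
  (a ∷ f) +ₚ []      = a ∷ f
  (a ∷ f) +ₚ (b ∷ g) = (a + b) ∷ (f +ₚ g)

  infixl 7 _*ₚ_
  _*ₚ_ : Poly → Poly → Poly
  []      *ₚ g = []
  (a ∷ f) *ₚ g = map (a *_) g +ₚ (0# ∷ (f *ₚ g))

  derivative : Poly → Poly
  derivative []      = []
  derivative (_ ∷ f) = go 1 f
    where
    go : ℕ → Poly → Poly
    go k []      = []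
    go k (a ∷ g) = (k · a) ∷ go (suc k) g

  CoprimeToDerivative : Poly → Set
  CoprimeToDerivative f = ∃[ u ] ∃[ v ] (u *ₚ f +ₚ v *ₚ derivative f) ≈ₚ (1# ∷ [])

  Matrix : ℕ → Set
  Matrix n = Fin n → Fin n → Carrier

  det : ∀ {n} → Matrix n → Carrier
  det {zero}  M = 1#
  det {suc n} M =
    sum (λ j → (- 1#) ^ toℕ j * (M zero j * det (λ i k → M (suc i) (punchIn j k))))

  -- For f of degree m and g of degree n, the rows are the coefficients of
  -- xⁿ⁻¹f, …, xf, f, xᵐ⁻¹g, …, xg, g, each listed from xⁿ⁺ᵐ⁻¹ down to x⁰.
  sylvester : (f : Poly) (m : ℕ) (g : Poly) (n : ℕ) → Matrix (n ℕ.+ m)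
  sylvester f m g n i j =
    coeff ([ (λ r → shift r f) , (λ r → shift r g) ]′ (splitAt n i)) (toℕ (opposite j))
    where
    shift : ∀ {k} → Fin k → Poly → Poly
    shift r h = replicate (toℕ (opposite r)) 0# ++ h

  resultant : (f : Poly) (m : ℕ) (g : Poly) (n : ℕ) → Carrier
  resultant f m g n = det (sylvester f m g n)

  -- Δ = (-1)^(n(n-1)/2) aₙ⁻¹ Res(f, f′) for f of degree n ≥ 1 with leading
  -- coefficient aₙ, written without division.  Here f′ is given the formal
  -- degree n - 1, also when its actual degree is smaller because the
  -- characteristic divides n.
  IsDiscriminant : (f : Poly) (n : ℕ) → Carrier → Set
  IsDiscriminant f n Δ =
    coeff f n * Δ ≈ (- 1#) ^ ((n ℕ.* ℕ.pred n) / 2) * resultant f n (derivative f) (ℕ.pred n)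

  -- Points with coordinates in R of the smooth projective curve y² = f(x),
  -- f of even degree n.  In the chart at infinity the points at infinity are
  -- the square roots of the leading coefficient of f.
  data CurvePoint (f : Poly) (n : ℕ) : Set where
    affine   : (x y : Carrier) → y * y ≈ eval f x → CurvePoint f n
    infinity : (s : Carrier) → s * s ≈ coeff f n → CurvePoint f n

  -- Points of d y² = f(x) that are neither at infinity nor have f(x) = 0.
  NontrivialTwistPoint : Carrier → Poly → Set
  NontrivialTwistPoint d f =
    ∃[ x ] ∃[ y ] (d * (y * y) ≈ eval f x × ¬ (eval f x ≈ 0#))

open Polynomial

ℤ[x] : Set
ℤ[x] = Poly ℤ.+-*-rawRing

HasDegreeℤ : ℤ[x] → ℕ → Set
HasDegreeℤ = HasDegree ℤ.+-*-rawRing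

-- No repeated roots in an algebraic closure of ℚ, i.e. f and f′ generate the
-- unit ideal of ℚ[x].
Separable : ℤ[x] → Set
Separable f = CoprimeToDerivative ℚ.+-*-rawRing (map (λ a → a ℚ./ 1) f)

infix 4 _≡_[mod_]
_≡_[mod_] : ℤ → ℤ → ℕ → Set
a ≡ b [mod m ] = + m ∣ a ℤ.- b

-- ℤ/p: integers, with congruence modulo p as the equality.
𝔽 : ℕ → RawRing 0ℓ 0ℓ
𝔽 p = record
  { Carrier = ℤ
  ; _≈_     = λ a b → a ≡ b [mod p ]
  ; _+_     = ℤ._+_
  ; _*_     = ℤ._*_
  ; -_      = ℤ.-_
  ; 0#      = 0ℤ
  ; 1#      = 1ℤ
  }

-- The identity on representatives, since residue classes are represented by
-- integers.
reduce : (p : ℕ) → ℤ[x] → Poly (𝔽 p)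
reduce p f = f

-- n is the degree of f.
record Good (f : ℤ[x]) (n : ℕ) (p : ℕ) : Set where
  field
    prime               : Prime p
    odd                 : p ≢ 2
    sameDegree          : HasDegree (𝔽 p) (reduce p f) n
    nonzeroDiscriminant : ∃[ Δ ] (IsDiscriminant (𝔽 p) (reduce p f) n Δ × ¬ (Δ ≡ 0ℤ [mod p ]))

Squarefree : ℤ → Set
Squarefree d = d ≢ 0ℤ × (∀ k → k ℤ.* k ∣ d → k ∣ 1ℤ)

NonzeroSquareMod : ℕ → ℤ → Set
NonzeroSquareMod p d = ¬ (d ≡ 0ℤ [mod p ]) × ∃[ e ] e ℤ.* e ≡ d [mod p ]

mod-refl : ∀ m a → a ≡ a [mod m ]
mod-refl m a = divides 0ℤ (+-inverseʳ a)

mod-+ : ∀ m a a′ b b′ → a ≡ a′ [mod m ] → b ≡ b′ [mod m ] → a ℤ.+ b ≡ a′ ℤ.+ b′ [mod m ]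
mod-+ m a a′ b b′ p q = subst (+ m ∣_) (eq a a′ b b′) (∣m∣n⇒∣m+n p q)
  where
  eq : ∀ a a′ b b′ → (a ℤ.- a′) ℤ.+ (b ℤ.- b′) ≡ (a ℤ.+ b) ℤ.- (a′ ℤ.+ b′)
  eq = solve-∀

mod-neg : ∀ m a a′ → a ≡ a′ [mod m ] → ℤ.- a ≡ ℤ.- a′ [mod m ]
mod-neg m a a′ p = subst (+ m ∣_) (eq a a′) (∣m⇒∣-m p)
  where
  eq : ∀ a a′ → ℤ.- (a ℤ.- a′) ≡ (ℤ.- a) ℤ.- (ℤ.- a′)
  eq = solve-∀

mod-* : ∀ m a a′ b b′ → a ≡ a′ [mod m ] → b ≡ b′ [mod m ] → a ℤ.* b ≡ a′ ℤ.* b′ [mod m ]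
mod-* m a a′ b b′ p q =
  subst (+ m ∣_) (eq a a′ b b′) (∣m∣n⇒∣m+n (∣n⇒∣m*n a q) (∣m⇒∣m*n b′ p))
  where
  eq : ∀ a a′ b b′ → a ℤ.* (b ℤ.- b′) ℤ.+ (a ℤ.- a′) ℤ.* b′ ≡ a ℤ.* b ℤ.- a′ ℤ.* b′
  eq = solve-∀

-- ℤₚ as the inverse limit of the rings ℤ/pⁿ: approx n represents the image
-- in ℤ/pⁿ.
record ℤₚ (p : ℕ) : Set where
  field
    approx   : ℕ → ℤ
    coherent : ∀ n → approx (suc n) ≡ approx n [mod p ℕ.^ n ]

open ℤₚ

module _ {p : ℕ} where

  infix 4 _≈ᶻ_
  _≈ᶻ_ : ℤₚ p → ℤₚ p → Set
  a ≈ᶻ b = ∀ n → approx a n ≡ approx b n [mod p ℕ.^ n ]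

  fromℤ : ℤ → ℤₚ p
  fromℤ a .approx _   = a
  fromℤ a .coherent n = mod-refl (p ℕ.^ n) a

  infixl 6 _+ᶻ_
  _+ᶻ_ : ℤₚ p → ℤₚ p → ℤₚ p
  (a +ᶻ b) .approx n   = approx a n ℤ.+ approx b n
  (a +ᶻ b) .coherent n =
    mod-+ (p ℕ.^ n) (approx a (suc n)) (approx a n) (approx b (suc n)) (approx b n)
      (coherent a n) (coherent b n)

  infixl 7 _*ᶻ_
  _*ᶻ_ : ℤₚ p → ℤₚ p → ℤₚ p
  (a *ᶻ b) .approx n   = approx a n ℤ.* approx b n
  (a *ᶻ b) .coherent n =
    mod-* (p ℕ.^ n) (approx a (suc n)) (approx a n) (approx b (suc n)) (approx b n)
      (coherent a n) (coherent b n)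

  infix 8 -ᶻ_
  -ᶻ_ : ℤₚ p → ℤₚ p
  (-ᶻ a) .approx n   = ℤ.- approx a n
  (-ᶻ a) .coherent n = mod-neg (p ℕ.^ n) (approx a (suc n)) (approx a n) (coherent a n)

-- ℚₚ as ℤₚ[1/p]: num ÷p^ k is the fraction num / pᵏ.  Multiplication by p is
-- injective on ℤₚ for p prime, so fractions are compared by cross-multiplying.
record ℚₚ (p : ℕ) : Set where
  constructor _÷p^_
  field
    num : ℤₚ p
    exp : ℕ

module _ {p : ℕ} where

  infix 9 p^_
  p^_ : ℕ → ℤₚ p
  p^ k = fromℤ (+ (p ℕ.^ k))

  infix 4 _≈ᵠ_
  _≈ᵠ_ : ℚₚ p → ℚₚ p → Set
  (a ÷p^ k) ≈ᵠ (b ÷p^ l) = a *ᶻ (p^ l) ≈ᶻ b *ᶻ (p^ k)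

  infixl 6 _+ᵠ_
  _+ᵠ_ : ℚₚ p → ℚₚ p → ℚₚ p
  (a ÷p^ k) +ᵠ (b ÷p^ l) = (a *ᶻ (p^ l) +ᶻ b *ᶻ (p^ k)) ÷p^ (k ℕ.+ l)

  infixl 7 _*ᵠ_
  _*ᵠ_ : ℚₚ p → ℚₚ p → ℚₚ p
  (a ÷p^ k) *ᵠ (b ÷p^ l) = (a *ᶻ b) ÷p^ (k ℕ.+ l)

  infix 8 -ᵠ_
  -ᵠ_ : ℚₚ p → ℚₚ p
  -ᵠ (a ÷p^ k) = (-ᶻ a) ÷p^ k

ℚₚ-rawRing : ℕ → RawRing 0ℓ 0ℓ
ℚₚ-rawRing p = record
  { Carrier = ℚₚ p
  ; _≈_     = _≈ᵠ_
  ; _+_     = _+ᵠ_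
  ; _*_     = _*ᵠ_
  ; -_      = -ᵠ_
  ; 0#      = fromℤ 0ℤ ÷p^ 0
  ; 1#      = fromℤ 1ℤ ÷p^ 0
  }

ℤ→ℚₚ : (p : ℕ) → ℤ → ℚₚ p
ℤ→ℚₚ p a = fromℤ a ÷p^ 0

HasNontrivialℚₚPoint : ℕ → ℤ → ℤ[x] → Set
HasNontrivialℚₚPoint p d f =
  NontrivialTwistPoint (ℚₚ-rawRing p) (ℤ→ℚₚ p d) (map (ℤ→ℚₚ p) f)

{-# OPTIONS --safe #-}

-- Clearing denominators and truncating modulo a high power of p turns a ℚₚ-point
-- into integers A, B with d (B/pˡ)² ≡ f(A/pᵏ) modulo p.  After cancelling common
-- factors of p from A and pᵏ, either the denominator is 1, and reducing modulo p
-- gives an affine point of C, or A = u is prime to p and the denominator q is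
-- divisible by p; then qⁿ f(u/q) ≡ aₙ uⁿ modulo p, and as n is even, aₙ is a
-- square modulo p, which gives a point at infinity.  In both cases d is absorbed into
-- y because it is a square modulo p.

module Submission where

open import Defs
open import Data.Empty using (⊥)
open import Data.Integer.Base as ℤ using (ℤ; +_; 0ℤ; 1ℤ; ∣_∣; _+_; _*_; _-_; -_; _^_)
import Data.Integer.Divisibility.Signed as ℤ∣
open ℤ∣ using (divides; ∣m∣n⇒∣m+n; ∣n⇒∣m*n; ∣m⇒∣m*n; *-cancelˡ-∣) renaming (_∣_ to _∣ℤ_)
import Data.Integer.Properties as ℤ
open import Data.Integer.Tactic.RingSolver using (solve-∀)
open import Data.List.Base using ([]; _∷_; length; map)
open import Data.Nat.Base as ℕ using (ℕ; zero; suc; _<_; z<s; s<s)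
open import Data.Nat.Coprimality using (Coprime; coprime-Bézout)
open import Data.Nat.Divisibility using (_∣_)
import Data.Nat.Divisibility as ℕ∣
open import Data.Nat.GCD using (module Bézout)
open import Data.Nat.Primality using (Prime; euclidsLemma; prime⇒irreducible; prime⇒nonZero; ¬prime[1])
import Data.Nat.Properties as ℕ
open import Data.Product.Base using (_×_; _,_; ∃-syntax)
open import Data.Sum.Base as Sum using (_⊎_; inj₁; inj₂)
open import Relation.Binary.PropositionalEquality using (_≡_; refl; sym; trans; cong; cong₂; subst; subst₂; module ≡-Reasoning)
open import Relation.Nullary.Decidable using (Dec; yes; no)
open import Relation.Nullary.Negation using (¬_; contradiction)

open ℤₚ using (approx)
open ℚₚ using (num; exp)

-- Powers of integers

^-distribʳ-* : ∀ a b n → (a * b) ^ n ≡ a ^ n * b ^ n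
^-distribʳ-* a b zero    = refl
^-distribʳ-* a b (suc n) = begin
  (a * b) * (a * b) ^ n    ≡⟨ cong ((a * b) *_) (^-distribʳ-* a b n) ⟩
  (a * b) * (a ^ n * b ^ n) ≡⟨ interchange a b (a ^ n) (b ^ n) ⟩
  (a * a ^ n) * (b * b ^ n) ∎
  where
  open ≡-Reasoning
  interchange : ∀ a b x y → (a * b) * (x * y) ≡ (a * x) * (b * y)
  interchange = solve-∀

-- The exponent has the form in which a proof of `2 ∣ n` presents `n`; this is how the evenness of
-- the degree is used.
^-double : ∀ a m → a ^ (m ℕ.* 2) ≡ a ^ m * a ^ m
^-double a m = begin
  a ^ (m ℕ.* 2)       ≡⟨ ℤ.^-*-assoc a m 2 ⟨
  a ^ m * (a ^ m * 1ℤ) ≡⟨ cong (a ^ m *_) (ℤ.*-identityʳ (a ^ m)) ⟩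
  a ^ m * a ^ m       ∎
  where open ≡-Reasoning

pos-^ : ∀ m n → + (m ℕ.^ n) ≡ (+ m) ^ n
pos-^ m zero    = refl
pos-^ m (suc n) = trans (ℤ.pos-* m (m ℕ.^ n)) (cong (+ m *_) (pos-^ m n))

^-nonZero : ∀ a n .{{_ : ℤ.NonZero a}} → ℤ.NonZero (a ^ n)
^-nonZero a zero    = _
^-nonZero a (suc n) = ℤ.i*j≢0 a (a ^ n)
  where instance _ = ^-nonZero a n

-- The factorisations are arguments, so that each use can supply them from the ring solver.
cancel-∣ : ∀ c {i j m x} .{{_ : ℤ.NonZero c}} → m ≡ c * i → x ≡ c * j → m ∣ℤ x → i ∣ℤ j
cancel-∣ c {i} {j} refl refl = *-cancelˡ-∣ c {i} {j}

i∣i*j : ∀ i j → i ∣ℤ i * j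
i∣i*j i j = divides j (ℤ.*-comm i j)

∣-sum : ∀ {i m n k} → i ∣ℤ m → i ∣ℤ n → m + n ≡ k → i ∣ℤ k
∣-sum i∣m i∣n refl = ∣m∣n⇒∣m+n i∣m i∣n

-- Homogenised evaluation

coeffℤ : ℤ[x] → ℕ → ℤ
coeffℤ = Polynomial.coeff ℤ.+-*-rawRing

evalℤ : ℤ[x] → ℤ → ℤ
evalℤ = Polynomial.eval ℤ.+-*-rawRing

-- homogenize f u q = q^(length f) f(u/q)
homogenize : ℤ[x] → ℤ → ℤ → ℤ
homogenize []      u q = 0ℤ
homogenize (a ∷ f) u q = a * q ^ suc (length f) + u * homogenize f u q

homogenize-scale : ∀ c f u q → homogenize f (c * u) (c * q) ≡ c ^ length f * homogenize f u q
homogenize-scale c []      u q = refl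
homogenize-scale c (a ∷ f) u q = begin
  a * (c * q) ^ suc (length f) + (c * u) * homogenize f (c * u) (c * q)
    ≡⟨ cong₂ (λ y z → a * y + (c * u) * z) (^-distribʳ-* c q (suc (length f))) (homogenize-scale c f u q) ⟩
  a * ((c * c ^ length f) * q ^ suc (length f)) + (c * u) * (c ^ length f * homogenize f u q)
    ≡⟨ factor a c u (c ^ length f) (q ^ suc (length f)) (homogenize f u q) ⟩
  (c * c ^ length f) * (a * q ^ suc (length f) + u * homogenize f u q) ∎
  where
  open ≡-Reasoning
  factor : ∀ a c u x y h → a * ((c * x) * y) + (c * u) * (x * h) ≡ (c * x) * (a * y + u * h)
  factor = solve-∀

homogenize-1 : ∀ f u → homogenize f u 1ℤ ≡ evalℤ f u
homogenize-1 []      u = refl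
homogenize-1 (a ∷ f) u = cong₂ (λ y z → y + u * z)
  (trans (cong (a *_) (ℤ.^-zeroˡ (suc (length f)))) (ℤ.*-identityʳ a)) (homogenize-1 f u)

homogenize-zero : ∀ f u q → (∀ m → coeffℤ f m ≡ 0ℤ) → homogenize f u q ≡ 0ℤ
homogenize-zero []      u q f≈0 = refl
homogenize-zero (a ∷ f) u q f≈0 = begin
  a * q ^ suc (length f) + u * homogenize f u q
    ≡⟨ cong₂ (λ y z → y * q ^ suc (length f) + u * z) (f≈0 0) (homogenize-zero f u q (λ m → f≈0 (suc m))) ⟩
  0ℤ * q ^ suc (length f) + u * 0ℤ ≡⟨ zeros (q ^ suc (length f)) u ⟩
  0ℤ ∎
  where
  open ≡-Reasoning
  zeros : ∀ x u → 0ℤ * x + u * 0ℤ ≡ 0ℤ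
  zeros = solve-∀

-- The exponent in `homogenize` is the list length, which exceeds the degree by `suc r` when there
-- are `r` trailing zeros; this accounts for the factor `q ^ suc r`. What remains is the form of
-- degree `n`, in which every term but the leading one contains `q`.
homogenize-leading : ∀ f n u q → HasDegreeℤ f n →
  ∃[ r ] ∃[ t ] (length f ≡ n ℕ.+ suc r × homogenize f u q ≡ q ^ suc r * (coeffℤ f n * u ^ n + q * t))
homogenize-leading []      n       u q (lead≢0 , _) = contradiction refl lead≢0
homogenize-leading (a ∷ f) zero    u q (_ , above≡0) = length f , 0ℤ , refl , (begin
  a * q ^ suc (length f) + u * homogenize f u q
    ≡⟨ cong (λ z → a * q ^ suc (length f) + u * z) (homogenize-zero f u q (λ m → above≡0 (suc m) z<s)) ⟩
  a * q ^ suc (length f) + u * 0ℤ ≡⟨ rearrange a (q ^ suc (length f)) u q ⟩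
  q ^ suc (length f) * (a * 1ℤ + q * 0ℤ) ∎)
  where
  open ≡-Reasoning
  rearrange : ∀ a x u q → a * x + u * 0ℤ ≡ x * (a * 1ℤ + q * 0ℤ)
  rearrange = solve-∀
homogenize-leading (a ∷ f) (suc n) u q (lead≢0 , above≡0)
  with homogenize-leading f n u q (lead≢0 , λ m n<m → above≡0 (suc m) (s<s n<m))
... | r , t , len , eq = r , u * t + a * q ^ n , cong suc len , (begin
  a * (q * q ^ length f) + u * homogenize f u q
    ≡⟨ cong₂ (λ y z → a * (q * y) + u * z) (trans (cong (q ^_) len) (ℤ.^-distribˡ-+-* q n (suc r))) eq ⟩
  a * (q * (q ^ n * q ^ suc r)) + u * (q ^ suc r * (coeffℤ f n * u ^ n + q * t))
    ≡⟨ rearrange a q (q ^ n) (q ^ suc r) u (coeffℤ f n) (u ^ n) t ⟩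
  q ^ suc r * (coeffℤ f n * (u * u ^ n) + q * (u * t + a * q ^ n)) ∎)
  where
  open ≡-Reasoning
  rearrange : ∀ a q x y u c v t →
    a * (q * (x * y)) + u * (y * (c * v + q * t)) ≡ y * (c * (u * v) + q * (u * t + a * x))
  rearrange = solve-∀

-- Coefficients and values over `𝔽 p` and `ℚₚ` in terms of integers

coeff-reduce : ∀ p f n → Polynomial.coeff (𝔽 p) f n ≡ coeffℤ f n
coeff-reduce p []      n       = refl
coeff-reduce p (a ∷ f) zero    = refl
coeff-reduce p (a ∷ f) (suc n) = coeff-reduce p f n

eval-reduce : ∀ p f x → Polynomial.eval (𝔽 p) f x ≡ evalℤ f x
eval-reduce p []      x = refl
eval-reduce p (a ∷ f) x = cong (λ z → a + x * z) (eval-reduce p f x)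

module _ {p : ℕ} (x : ℚₚ p) where
  private
    evalℚₚ : ℤ[x] → ℚₚ p
    evalℚₚ f = Polynomial.eval (ℚₚ-rawRing p) (map (ℤ→ℚₚ p) f) x

  exp-evalℚₚ : ∀ f → exp (evalℚₚ f) ≡ length f ℕ.* exp x
  exp-evalℚₚ []      = refl
  exp-evalℚₚ (a ∷ f) = cong (exp x ℕ.+_) (exp-evalℚₚ f)

  pos-p^exp-evalℚₚ : ∀ f → + (p ℕ.^ exp (evalℚₚ f)) ≡ ((+ p) ^ exp x) ^ length f
  pos-p^exp-evalℚₚ f = begin
    + (p ℕ.^ exp (evalℚₚ f))     ≡⟨ pos-^ p (exp (evalℚₚ f)) ⟩
    (+ p) ^ exp (evalℚₚ f)       ≡⟨ cong ((+ p) ^_) (trans (exp-evalℚₚ f) (ℕ.*-comm (length f) (exp x))) ⟩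
    (+ p) ^ (exp x ℕ.* length f) ≡⟨ ℤ.^-*-assoc (+ p) (exp x) (length f) ⟨
    ((+ p) ^ exp x) ^ length f   ∎
    where open ≡-Reasoning

  -- Fractions in `ℚₚ` are never reduced, so Horner evaluation builds up exactly the homogenised
  -- polynomial: adding the constant `a` multiplies it by the whole denominator, and the other
  -- summand is multiplied by `p ^ 0`.
  num-evalℚₚ : ∀ f N → approx (num (evalℚₚ f)) N ≡ homogenize f (approx (num x) N) ((+ p) ^ exp x)
  num-evalℚₚ []      N = refl
  num-evalℚₚ (a ∷ f) N = cong₂ (λ y z → a * y + z) (pos-p^exp-evalℚₚ (a ∷ f))
    (trans (ℤ.*-identityʳ _) (cong (approx (num x) N *_) (num-evalℚₚ f N)))

module _ {p : ℕ} (p-prime : Prime p) where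

  private
    P : ℤ
    P = + p

    instance
      P-nonZero : ℤ.NonZero P
      P-nonZero = prime⇒nonZero p-prime

  -- Arithmetic modulo a prime

  prime-∣* : ∀ a b → P ∣ℤ a * b → P ∣ℤ a ⊎ P ∣ℤ b
  prime-∣* a b P∣ab
    with euclidsLemma ∣ a ∣ ∣ b ∣ p-prime (subst (p ∣_) (ℤ.abs-* a b) (ℤ∣.∣⇒∣ᵤ P∣ab))
  ... | inj₁ p∣a = inj₁ (ℤ∣.∣ᵤ⇒∣ p∣a)
  ... | inj₂ p∣b = inj₂ (ℤ∣.∣ᵤ⇒∣ p∣b)

  prime-∣^ : ∀ a n → P ∣ℤ a ^ n → P ∣ℤ a
  prime-∣^ a zero    P∣1 =
    contradiction (subst Prime (ℕ∣.∣1⇒≡1 (ℤ∣.∣⇒∣ᵤ P∣1)) p-prime) ¬prime[1]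
  prime-∣^ a (suc n) P∣aⁿ⁺¹ with prime-∣* a (a ^ n) P∣aⁿ⁺¹
  ... | inj₁ P∣a  = P∣a
  ... | inj₂ P∣aⁿ = prime-∣^ a n P∣aⁿ

  -- Bézout's identity over ℕ for `p` and `∣ a ∣` has two cases, according to which multiple is
  -- larger by 1. Writing `∣ a ∣` as `z * a` restores the sign of `a`.
  inverse-mod : ∀ a → ¬ P ∣ℤ a → ∃[ w ] P ∣ℤ a * w - 1ℤ
  inverse-mod a P∤a = helper (coprime-Bézout coprime) ℤ∣.m∣∣m∣
    where
    coprime : Coprime p ∣ a ∣
    coprime (c∣p , c∣a) with prime⇒irreducible p-prime c∣p
    ... | inj₁ c≡1  = c≡1
    ... | inj₂ refl = contradiction (ℤ∣.∣ᵤ⇒∣ c∣a) P∤a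

    lift : ∀ y x b c → 1 ℕ.+ y ℕ.* b ≡ x ℕ.* c → 1ℤ + + y * + b ≡ + x * + c
    lift y x b c eq = begin
      1ℤ + + y * + b      ≡⟨ cong (λ z → 1ℤ + z) (ℤ.pos-* y b) ⟨
      1ℤ + + (y ℕ.* b)    ≡⟨ ℤ.pos-+ 1 (y ℕ.* b) ⟨
      + (1 ℕ.+ y ℕ.* b)   ≡⟨ cong +_ eq ⟩
      + (x ℕ.* c)         ≡⟨ ℤ.pos-* x c ⟩
      + x * + c           ∎
      where open ≡-Reasoning

    negative : ∀ a z y → a * (- y * z) - 1ℤ ≡ - (1ℤ + y * (z * a))
    negative = solve-∀

    positive : ∀ a z y → a * (y * z) - 1ℤ ≡ y * (z * a) - 1ℤ
    positive = solve-∀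

    cancel-1 : ∀ y → (1ℤ + y) - 1ℤ ≡ y
    cancel-1 = solve-∀

    helper : Bézout.Identity 1 p ∣ a ∣ → a ∣ℤ + ∣ a ∣ → ∃[ w ] P ∣ℤ a * w - 1ℤ
    helper (Bézout.+- x y eq) (divides z ∣a∣≡za) = - (+ y) * z , divides (- (+ x)) (begin
      a * (- (+ y) * z) - 1ℤ       ≡⟨ negative a z (+ y) ⟩
      - (1ℤ + + y * (z * a))       ≡⟨ cong (λ t → - (1ℤ + + y * t)) ∣a∣≡za ⟨
      - (1ℤ + + y * + ∣ a ∣)       ≡⟨ cong -_ (lift y x ∣ a ∣ p eq) ⟩
      - (+ x * P)                  ≡⟨ ℤ.neg-distribˡ-* (+ x) P ⟩
      - (+ x) * P                  ∎)
      where open ≡-Reasoning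
    helper (Bézout.-+ x y eq) (divides z ∣a∣≡za) = + y * z , divides (+ x) (begin
      a * (+ y * z) - 1ℤ       ≡⟨ positive a z (+ y) ⟩
      + y * (z * a) - 1ℤ       ≡⟨ cong (λ t → + y * t - 1ℤ) ∣a∣≡za ⟨
      + y * + ∣ a ∣ - 1ℤ       ≡⟨ cong (_- 1ℤ) (lift x y p ∣ a ∣ eq) ⟨
      (1ℤ + + x * P) - 1ℤ      ≡⟨ cancel-1 (+ x * P) ⟩
      + x * P                  ∎)
      where open ≡-Reasoning

  -- Removing powers of p from the denominator of y

  descend-step : ∀ d G C s → ¬ P ∣ℤ d →
    P * ((P * s) * (P * s)) ∣ℤ d * (C * C) - G * ((P * s) * (P * s)) →
    ∃[ c ] P * (s * s) ∣ℤ d * (c * c) - G * (s * s)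
  descend-step d G C s P∤d h = divide P∣C h
    where
    regroup : ∀ d C G P s → (d * (C * C) - G * ((P * s) * (P * s))) + P * (G * (s * (P * s))) ≡ d * (C * C)
    regroup = solve-∀

    pull-modulus : ∀ P s → P * ((P * s) * (P * s)) ≡ (P * P) * (P * (s * s))
    pull-modulus = solve-∀

    pull-difference : ∀ d C G P s →
      d * ((C * P) * (C * P)) - G * ((P * s) * (P * s)) ≡ (P * P) * (d * (C * C) - G * (s * s))
    pull-difference = solve-∀

    -- The modulus and `G * ((P * s) * (P * s))` are both multiples of `P`.
    P∣dC² : P ∣ℤ d * (C * C)
    P∣dC² = ∣-sum (ℤ∣.∣-trans (i∣i*j P ((P * s) * (P * s))) h) (i∣i*j P (G * (s * (P * s))))
      (regroup d C G P s)

    P∣C : P ∣ℤ C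
    P∣C = Sum.[ (λ P∣d → contradiction P∣d P∤d) , (λ P∣C² → Sum.reduce (prime-∣* C C P∣C²)) ]
      (prime-∣* d (C * C) P∣dC²)

    -- Once `C` is a multiple of `P`, the factor `P * P` cancels from the modulus as well as from
    -- the difference, so a congruence modulo `P` relative to the smaller denominator survives.
    divide : ∀ {C} → P ∣ℤ C → P * ((P * s) * (P * s)) ∣ℤ d * (C * C) - G * ((P * s) * (P * s)) →
      ∃[ c ] P * (s * s) ∣ℤ d * (c * c) - G * (s * s)
    divide (divides C′ refl) h =
      C′ , cancel-∣ (P * P) {{ℤ.i*j≢0 P P}} (pull-modulus P s) (pull-difference d C′ G P s) h

  -- If d is prime to p, then d (C/s)² ≡ G modulo p forces C/s to be p-integral.
  -- Powers of p enter through equations such as s ≡ P ^ l so that conversion checking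
  -- does not unfold integer products.
  descend : ∀ d G l {s} C → s ≡ P ^ l → ¬ P ∣ℤ d → P * (s * s) ∣ℤ d * (C * C) - G * (s * s) →
    ∃[ c ] P ∣ℤ d * (c * c) - G
  descend d G zero    {s} C s≡1 P∤d h = C , subst₂ _∣ℤ_
    (trans (cong (λ z → P * (z * z)) s≡1) (ℤ.*-identityʳ P))
    (cong (λ z → d * (C * C) - z) (trans (cong (λ z → G * (z * z)) s≡1) (ℤ.*-identityʳ G))) h
  descend d G (suc l) {s} C s≡P*Pˡ P∤d h =
    let c , h′ = descend-step d G C (P ^ l) P∤d
                   (subst (λ z → P * (z * z) ∣ℤ d * (C * C) - G * (z * z)) s≡P*Pˡ h)
    in descend d G l c refl P∤d h′

  -- After the descent, `d * (c * c)` is congruent to `G`, and a square root `e` of `d` modulo p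
  -- turns the left side into the square of `e * c`.
  square-mod : ∀ d G l {s} C → s ≡ P ^ l → NonzeroSquareMod p d →
    P * (s * s) ∣ℤ d * (C * C) - G * (s * s) → ∃[ r ] r * r ≡ G [mod p ]
  square-mod d G l C s≡Pˡ (d≢0 , e , e²≡d) h =
    let c , dc²≡G = descend d G l C s≡Pˡ (λ P∣d → d≢0 (subst (P ∣ℤ_) (sym (ℤ.+-identityʳ d)) P∣d)) h
    in e * c , ∣-sum (∣m⇒∣m*n (c * c) e²≡d) dc²≡G (combine e d c G)
    where
    combine : ∀ e d c G → (e * e - d) * (c * c) + (d * (c * c) - G) ≡ (e * c) * (e * c) - G
    combine = solve-∀

  divide-square-mod : ∀ a s u → ¬ P ∣ℤ u → s * s ≡ a * (u * u) [mod p ] → ∃[ r ] r * r ≡ a [mod p ]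
  divide-square-mod a s u P∤u s²≡au² =
    let w , uw≡1 = inverse-mod u P∤u
    -- With `w` inverse to `u`, the second summand is `a * ((u * w) * (u * w) - 1ℤ)`, factored as a
    -- difference of squares.
    in s * w , ∣-sum (∣n⇒∣m*n (w * w) s²≡au²) (∣n⇒∣m*n (a * (u * w + 1ℤ)) uw≡1) (combine s w a u)
    where
    combine : ∀ s w a u →
      (w * w) * (s * s - a * (u * u)) + (a * (u * w + 1ℤ)) * (u * w - 1ℤ) ≡ (s * w) * (s * w) - a
    combine = solve-∀

  -- Points modulo p with a denominator in x

  -- d (B/s)² ≡ f(A/q) modulo p, multiplied by q^(length f) s².
  PointModP : ℤ[x] → ℤ → ℤ → ℤ → ℤ → ℤ → Set
  PointModP f d A q B s =
    P * (q ^ length f * (s * s)) ∣ℤ d * (B * B) * q ^ length f - homogenize f A q * (s * s)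

  -- By homogeneity, the modulus and the difference both scale by `P ^ length f`.
  cancel-p : ∀ f d {A′ q′} A q B s → A′ ≡ P * A → q′ ≡ P * q →
    PointModP f d A′ q′ B s → PointModP f d A q B s
  cancel-p f d A q B s refl refl =
    cancel-∣ (P ^ length f) {{^-nonZero P (length f)}} modulus difference
    where
    pull-modulus : ∀ P L Q s → P * ((L * Q) * (s * s)) ≡ L * (P * (Q * (s * s)))
    pull-modulus = solve-∀

    pull-difference : ∀ d B L Q h s →
      d * (B * B) * (L * Q) - (L * h) * (s * s) ≡ L * (d * (B * B) * Q - h * (s * s))
    pull-difference = solve-∀

    modulus : P * ((P * q) ^ length f * (s * s)) ≡ P ^ length f * (P * (q ^ length f * (s * s)))
    modulus = trans (cong (λ z → P * (z * (s * s))) (^-distribʳ-* P q (length f)))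
      (pull-modulus P (P ^ length f) (q ^ length f) s)

    difference : d * (B * B) * (P * q) ^ length f - homogenize f (P * A) (P * q) * (s * s)
               ≡ P ^ length f * (d * (B * B) * q ^ length f - homogenize f A q * (s * s))
    difference = trans
      (cong₂ (λ y z → d * (B * B) * y - z * (s * s)) (^-distribʳ-* P q (length f)) (homogenize-scale P f A q))
      (pull-difference d B (P ^ length f) (q ^ length f) (homogenize f A q) s)

  -- Each common factor of p cancelled lowers `k` by one. Recursion on `k` also covers `A` equal to
  -- 0, where the cancelling stops only at denominator 1.
  lowest-terms : ∀ f d A k {q} B s → q ≡ P ^ k → PointModP f d A q B s →
    ∃[ u ] ∃[ j ] ((j ≡ 0 ⊎ ¬ P ∣ℤ u) × PointModP f d u (P ^ j) B s)
  lowest-terms f d A zero    B s q≡1 h =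
    A , zero , inj₁ refl , subst (λ z → PointModP f d A z B s) q≡1 h
  lowest-terms f d A (suc k) B s q≡P*Pᵏ h = split (P ℤ∣.∣? A)
    where
    split : Dec (P ∣ℤ A) → ∃[ u ] ∃[ j ] ((j ≡ 0 ⊎ ¬ P ∣ℤ u) × PointModP f d u (P ^ j) B s)
    split (no P∤A) = A , suc k , inj₂ P∤A , subst (λ z → PointModP f d A z B s) q≡P*Pᵏ h
    split (yes (divides A′ A≡A′P)) = lowest-terms f d A′ k B s refl
      (cancel-p f d A′ (P ^ k) B s (trans A≡A′P (ℤ.*-comm A′ P)) q≡P*Pᵏ h)

  integral-point : ∀ f d u {q} B l {s} → q ≡ 1ℤ → s ≡ P ^ l → NonzeroSquareMod p d →
    PointModP f d u q B s → ∃[ r ] r * r ≡ evalℤ f u [mod p ]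
  integral-point f d u {q} B l {s} refl s≡Pˡ sq h =
    square-mod d (evalℤ f u) l B s≡Pˡ sq (subst₂ _∣ℤ_ modulus difference h)
    where
    modulus : P * (1ℤ ^ length f * (s * s)) ≡ P * (s * s)
    modulus = cong (λ z → P * z) (trans (cong (λ z → z * (s * s)) (ℤ.^-zeroˡ (length f))) (ℤ.*-identityˡ (s * s)))

    difference : d * (B * B) * 1ℤ ^ length f - homogenize f u 1ℤ * (s * s)
               ≡ d * (B * B) - evalℤ f u * (s * s)
    difference = cong₂ (λ y z → y - z * (s * s))
      (trans (cong (λ z → d * (B * B) * z) (ℤ.^-zeroˡ (length f))) (ℤ.*-identityʳ (d * (B * B))))
      (homogenize-1 f u)

  -- As p divides `q`, the form of degree n is congruent to its leading term `aₙ uⁿ`. With n equal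
  -- to `m * 2`, the power `qⁿ` is a square and is absorbed into `B`, and `uⁿ` is the square of a
  -- unit modulo p and is divided out, leaving `aₙ` a square.
  polar-point : ∀ f d m u q q′ B l {s} → HasDegreeℤ f (m ℕ.* 2) → ¬ P ∣ℤ u → .{{_ : ℤ.NonZero q}} →
    q ≡ P * q′ → s ≡ P ^ l → NonzeroSquareMod p d →
    PointModP f d u q B s → ∃[ r ] r * r ≡ coeffℤ f (m ℕ.* 2) [mod p ]
  polar-point f d m u q q′ B l {s} deg P∤u q≡Pq′ s≡Pˡ sq h = square (homogenize-leading f (m ℕ.* 2) u q deg)
    where
    pull-modulus : ∀ P x R s → P * (((x * x) * R) * (s * s)) ≡ R * ((x * x) * (P * (s * s)))
    pull-modulus = solve-∀

    pull-difference : ∀ d B x R G s →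
      d * (B * B) * ((x * x) * R) - (R * G) * (s * s) ≡ R * (d * ((B * x) * (B * x)) - G * (s * s))
    pull-difference = solve-∀

    cancel : ∀ x y z → (x - (y + z)) + z ≡ x - y
    cancel = solve-∀

    q^length : ∀ {r} → length f ≡ m ℕ.* 2 ℕ.+ suc r → q ^ length f ≡ (q ^ m * q ^ m) * q ^ suc r
    q^length {r} len = trans (cong (λ z → q ^ z) len)
      (trans (ℤ.^-distribˡ-+-* q (m ℕ.* 2) (suc r)) (cong (λ z → z * q ^ suc r) (^-double q m)))

    -- multiply through by qⁿ = (qᵐ)²
    cancelled : ∀ {r G} → length f ≡ m ℕ.* 2 ℕ.+ suc r → homogenize f u q ≡ q ^ suc r * G →
      P * (s * s) ∣ℤ d * ((B * q ^ m) * (B * q ^ m)) - G * (s * s)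
    cancelled {r} {G} len eq = ℤ∣.∣-trans (∣n⇒∣m*n (q ^ m * q ^ m) ℤ∣.∣-refl)
      (cancel-∣ (q ^ suc r) {{^-nonZero q (suc r)}}
        (trans (cong (λ z → P * (z * (s * s))) (q^length len)) (pull-modulus P (q ^ m) (q ^ suc r) s))
        (trans (cong₂ (λ y z → d * (B * B) * y - z * (s * s)) (q^length len) eq)
          (pull-difference d B (q ^ m) (q ^ suc r) G s))
        h)

    P∣q : P ∣ℤ q
    P∣q = divides q′ (trans q≡Pq′ (ℤ.*-comm P q′))

    divide : ∀ a t → ∃[ r ] r * r ≡ a * u ^ (m ℕ.* 2) + q * t [mod p ] → ∃[ r ] r * r ≡ a [mod p ]
    divide a t (r , r²≡G) = divide-square-mod a r (u ^ m) (λ P∣uᵐ → P∤u (prime-∣^ u m P∣uᵐ))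
      (∣-sum r²≡G (∣m⇒∣m*n t P∣q)
        (trans (cancel (r * r) (a * u ^ (m ℕ.* 2)) (q * t)) (cong (λ z → r * r - a * z) (^-double u m))))

    square : ∃[ r ] ∃[ t ] (length f ≡ m ℕ.* 2 ℕ.+ suc r ×
        homogenize f u q ≡ q ^ suc r * (coeffℤ f (m ℕ.* 2) * u ^ (m ℕ.* 2) + q * t)) →
      ∃[ r ] r * r ≡ coeffℤ f (m ℕ.* 2) [mod p ]
    square (r , t , len , eq) = divide (coeffℤ f (m ℕ.* 2)) t
      (square-mod d (coeffℤ f (m ℕ.* 2) * u ^ (m ℕ.* 2) + q * t) l (B * q ^ m) s≡Pˡ sq (cancelled len eq))

  -- From equality in `ℚₚ` to a congruence of integers

  congruence⇒PointModP : ∀ f d A B k l E {h} → + (p ℕ.^ E) ≡ (P ^ k) ^ length f → h ≡ homogenize f A (P ^ k) →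
    d * (B * B) * + (p ℕ.^ E) ≡ h * + (p ℕ.^ (l ℕ.+ l)) [mod p ℕ.^ suc (E ℕ.+ (l ℕ.+ l)) ] →
    PointModP f d A (P ^ k) B (P ^ l)
  congruence⇒PointModP f d A B k l E {h} pᴱ≡ h≡ = subst₂ _∣ℤ_ modulus difference
    where
    open ≡-Reasoning
    p²ˡ≡ : + (p ℕ.^ (l ℕ.+ l)) ≡ P ^ l * P ^ l
    p²ˡ≡ = trans (pos-^ p (l ℕ.+ l)) (ℤ.^-distribˡ-+-* P l l)

    modulus : + (p ℕ.^ suc (E ℕ.+ (l ℕ.+ l))) ≡ P * ((P ^ k) ^ length f * (P ^ l * P ^ l))
    modulus = begin
      + (p ℕ.^ suc (E ℕ.+ (l ℕ.+ l)))         ≡⟨ ℤ.pos-* p (p ℕ.^ (E ℕ.+ (l ℕ.+ l))) ⟩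
      P * + (p ℕ.^ (E ℕ.+ (l ℕ.+ l)))         ≡⟨ cong (λ z → P * + z) (ℕ.^-distribˡ-+-* p E (l ℕ.+ l)) ⟩
      P * + (p ℕ.^ E ℕ.* p ℕ.^ (l ℕ.+ l))     ≡⟨ cong (λ z → P * z) (ℤ.pos-* (p ℕ.^ E) (p ℕ.^ (l ℕ.+ l))) ⟩
      P * (+ (p ℕ.^ E) * + (p ℕ.^ (l ℕ.+ l))) ≡⟨ cong₂ (λ v w → P * (v * w)) pᴱ≡ p²ˡ≡ ⟩
      P * ((P ^ k) ^ length f * (P ^ l * P ^ l)) ∎

    difference : d * (B * B) * + (p ℕ.^ E) - h * + (p ℕ.^ (l ℕ.+ l))
               ≡ d * (B * B) * (P ^ k) ^ length f - homogenize f A (P ^ k) * (P ^ l * P ^ l)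
    difference = cong₂ (λ v w → d * (B * B) * v - w) pᴱ≡ (cong₂ _*_ h≡ p²ˡ≡)

  ℚₚ-point⇒PointModP : ∀ f d → HasNontrivialℚₚPoint p d f →
    ∃[ A ] ∃[ k ] ∃[ B ] ∃[ l ] PointModP f d A (P ^ k) B (P ^ l)
  ℚₚ-point⇒PointModP f d (x , y , eq , _) =
    approx (num x) N , exp x , approx (num y) N , exp y ,
    congruence⇒PointModP f d (approx (num x) N) (approx (num y) N) (exp x) (exp y) E
      (pos-p^exp-evalℚₚ x f) (num-evalℚₚ x f N) (eq N)
    where
    E N : ℕ
    E = exp (Polynomial.eval (ℚₚ-rawRing p) (map (ℤ→ℚₚ p) f) x)
    -- Cross-multiplying introduces the denominators `p ^ E` of f(x) and `p ^ (exp y + exp y)` of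
    -- `d * (y * y)`. One further power of p leaves a congruence modulo p once both are divided out.
    N = suc (E ℕ.+ (exp y ℕ.+ exp y))

-- Contradiction with the absence of points over `𝔽 p`

lemma4p10 : (f : ℤ[x]) (n : ℕ) → HasDegreeℤ f n → 0 < n → 2 ∣ n → Separable f →
    (p : ℕ) → Good f n p → ¬ Polynomial.CurvePoint (𝔽 p) (reduce p f) n →
    (d : ℤ) → Squarefree d → NonzeroSquareMod p d →
    ¬ HasNontrivialℚₚPoint p d f
lemma4p10 f _ deg _ (ℕ∣.divides m refl) _ p good no-point d _ sq point =
  let A , k , B , l , h = ℚₚ-point⇒PointModP p-prime f d point
      u , j , coprime , h′ = lowest-terms p-prime f d A k B ((+ p) ^ l) refl h
  in absurd u j B l coprime h′
  where
  p-prime : Prime p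
  p-prime = Good.prime good

  no-affine-point : ∀ u → ¬ (∃[ s ] s * s ≡ evalℤ f u [mod p ])
  no-affine-point u (s , s²≡fu) =
    no-point (Polynomial.affine u s (subst (s * s ≡_[mod p ]) (sym (eval-reduce p f u)) s²≡fu))

  no-infinite-point : ¬ (∃[ s ] s * s ≡ coeffℤ f (m ℕ.* 2) [mod p ])
  no-infinite-point (s , s²≡a) =
    no-point (Polynomial.infinity s (subst (s * s ≡_[mod p ]) (sym (coeff-reduce p f (m ℕ.* 2))) s²≡a))

  absurd : ∀ u j B l → j ≡ 0 ⊎ ¬ (+ p ∣ℤ u) → PointModP p-prime f d u ((+ p) ^ j) B ((+ p) ^ l) → ⊥
  absurd u zero    B l _          h = no-affine-point u (integral-point p-prime f d u B l refl refl sq h)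
  -- A positive exponent excludes `inj₁`, and `(+ p) ^ j` is the cofactor showing that p divides the
  -- denominator.
  absurd u (suc j) B l (inj₂ p∤u) h = no-infinite-point
    (polar-point p-prime f d m u ((+ p) ^ suc j) ((+ p) ^ j) B l deg p∤u
      {{^-nonZero (+ p) (suc j) {{prime⇒nonZero p-prime}}}} refl refl sq h)
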